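{- Let $n\ge 4$ and let $\mathbb{D}$ be a $\vec{\mathbb{P}}_3$-free digraph. Then $\mathbb{D}$ admits a homomorphism to $\mathbb{TC}_n$ if and only if $\mathbb{D}$ is a loopless oriented graph with no induced subgraph isomorphic to any of $\mathbb{T}_4^a$, $\mathbb{T}_4^b$, $\mathbb{RT}_5$, $\mathbb{T}_5^c$, $\mathbb{TT}_n$, $\mathbb{TC}_{n+1}$.
   Context: $\vec{\mathbb{P}}_3$ is the directed path $1\to2\to3$; $\vec{\mathbb{P}}_3$-free means no induced subgraph isomorphic to it. An oriented graph has no pair of symmetric edges $(u,v),(v,u)$. $\mathbb{TT}_m$ is the transitive tournament on $\{1,\dots,m\}$ with edges $(i,j)$ for $i<j$, and $\mathbb{TC}_m$ is obtained from $\mathbb{TT}_m$ by reversing the edge $(1,m)$ to $(m,1)$. $\mathbb{T}_4^a$: vertices $1,2,3,4$, edges $(1,2),(1,3),(1,4),(2,3),(3,4),(4,2)$ (a source dominating a directed triangle). $\mathbb{T}_4^b$: edges $(2,1),(3,1),(4,1),(2,3),(3,4),(4,2)$ (a directed triangle dominating a sink). $\mathbb{RT}_5$: vertices $\mathbb{Z}_5$, edge $(i,j)$ iff $j-i\in\{1,3\}\pmod 5$. $\mathbb{T}_5^c$: vertices $1,\dots,5$, edges $(1,2),(2,3),(3,4),(1,3),(1,4),(2,4),(5,1),(5,2),(3,5),(4,5)$. -}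

module Defs where

open import Data.Nat using (ℕ; zero; suc; _∸_; _+_; _<ᵇ_; _≡ᵇ_; _%_)
open import Data.Fin using (Fin; toℕ)
open import Data.Bool using (Bool; true; false; _∧_; _∨_; not)
open import Data.List using (List; []; _∷_)
open import Data.Bool.ListAction using (any)
open import Data.Empty using (⊥)
open import Data.Product using (Σ; _×_; _,_)
open import Relation.Binary.PropositionalEquality using (_≡_)
open import Function.Definitions using (Injective)

record Digraph : Set where
  field
    size : ℕ
    edge : Fin size → Fin size → Bool
open Digraph public

-- Digraph on vertices labelled 1..k (vertex i : Fin k has label 1 + toℕ i)
-- with the listed edges (a , b) meaning a → b.
fromEdges : (k : ℕ) → List (ℕ × ℕ) → Digraph
fromEdges k es = record
  { size = k
  ; edge = λ i j → any (λ { (a , b) → (suc (toℕ i) ≡ᵇ a) ∧ (suc (toℕ j) ≡ᵇ b) }) es }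

Hom : Digraph → Digraph → Set
Hom D H = Σ (Fin (size D) → Fin (size H)) λ f →
  ∀ u v → edge D u v ≡ true → edge H (f u) (f v) ≡ true

InducedSub : Digraph → Digraph → Set
InducedSub H D = Σ (Fin (size H) → Fin (size D)) λ g →
  Injective _≡_ _≡_ g × (∀ i j → edge D (g i) (g j) ≡ edge H i j)

Loopless : Digraph → Set
Loopless D = ∀ v → edge D v v ≡ false

Oriented : Digraph → Set
Oriented D = ∀ u v → edge D u v ≡ true → edge D v u ≡ false

P3 : Digraph
P3 = fromEdges 3 ((1 , 2) ∷ (2 , 3) ∷ [])

P3free : Digraph → Set
P3free D = InducedSub P3 D → ⊥

TT : ℕ → Digraph
TT m = record { size = m ; edge = λ i j → toℕ i <ᵇ toℕ j }

-- TC_m: TT_m with the edge (1,m) reversed to (m,1).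
-- In 0-based labels: remove 0 → m-1, add m-1 → 0 (only when m ≥ 2).
TC : ℕ → Digraph
TC m = record
  { size = m
  ; edge = λ i j →
      ((toℕ i <ᵇ toℕ j) ∧ not ((toℕ i ≡ᵇ 0) ∧ (toℕ j ≡ᵇ (m ∸ 1))))
      ∨ ((1 <ᵇ m) ∧ (toℕ i ≡ᵇ (m ∸ 1)) ∧ (toℕ j ≡ᵇ 0)) }

T4a : Digraph
T4a = fromEdges 4 ((1 , 2) ∷ (1 , 3) ∷ (1 , 4) ∷ (2 , 3) ∷ (3 , 4) ∷ (4 , 2) ∷ [])

T4b : Digraph
T4b = fromEdges 4 ((2 , 1) ∷ (3 , 1) ∷ (4 , 1) ∷ (2 , 3) ∷ (3 , 4) ∷ (4 , 2) ∷ [])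

-- RT_5 on Z_5 (vertex i : Fin 5 is residue toℕ i): i → j iff j - i ∈ {1,3} mod 5.
RT5 : Digraph
RT5 = record
  { size = 5
  ; edge = λ i j → let d = ((toℕ j + 5) ∸ toℕ i) % 5 in (d ≡ᵇ 1) ∨ (d ≡ᵇ 3) }

T5c : Digraph
T5c = fromEdges 5 ((1 , 2) ∷ (2 , 3) ∷ (3 , 4) ∷ (1 , 3) ∷ (1 , 4) ∷ (2 , 4)
                   ∷ (5 , 1) ∷ (5 , 2) ∷ (3 , 5) ∷ (4 , 5) ∷ [])

{-# OPTIONS --safe #-}
module Submission where

-- A loopless oriented P3-free digraph is quasi-transitive: u → v → w makes u and w adjacent. Fix a
-- triangle a → b → c → a. Forbidding T4a and T4b, every vertex adjacent to the triangle lies in one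
-- of the classes A = {c → v → b}, B = {a → v → c}, C = {b → v → a}, and A ∪ B ∪ C is a connected
-- component. Forbidding also RT5, the classes dominate each other completely, A → B → C → A;
-- forbidding T5c, at most one of them contains an edge. Rotating the triangle so that this is B, map
-- A to the first vertex of TC_n, C to the last, and B by height; a chain in B too long for this would
-- form a TC_{n+1} with a and c. Vertices covered by no triangle induce a strict partial order without
-- TT_n and are again mapped by height. Conversely, a tournament maps injectively into TC_n, where all
-- triangles share the edge from the last vertex to the first.

open import Defs
open import Data.Bool using (true; false)
open import Data.Bool.Properties using (¬-not) renaming (_≟_ to _≟ᴮ_)
open import Data.Empty using (⊥; ⊥-elim)
open import Data.Fin using (Fin; #_; zero; suc; toℕ; fromℕ; fromℕ<; opposite; punchOut)
open import Data.Fin.Properties using (_≟_; any?; all?; toℕ<n; toℕ-injective; toℕ-fromℕ; toℕ-fromℕ<;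
  opposite-prop; punchOut-injective; injective⇒≤)
open import Data.List using (List; []; _∷_; allFin; cartesianProduct)
open import Data.List.Membership.Propositional using (lose)
open import Data.List.Membership.Propositional.Properties using (∈-allFin; ∈-cartesianProduct⁺)
import Data.List.Relation.Unary.Any as Any
open import Data.List.Relation.Unary.Any using (Any; here; there)
open import Data.Nat using (ℕ; zero; suc; _≤_; _<_; _+_; _∸_; z≤n; s≤s; s≤s⁻¹; _<?_) renaming (_≟_ to _≟ᴺ_)
open import Data.Nat.Properties using (≤-refl; ≤-trans; <-trans; <-irrefl; <-asym; <-cmp;
  +-comm; +-suc; +-mono-≤; m≤n⇒m≤1+n; 1+n≰n; n≮0; 0<1+n; ∸-monoʳ-<;
  ≤-antisym; n∸n≡0; suc-injective; m∸n≡0⇒m≤n; 1+n≢0)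
open import Data.Product using (Σ; ∃; _×_; _,_; proj₁; proj₂)
open import Data.Sum using (_⊎_; inj₁; inj₂; swap) renaming (map to map⊎)
open import Function using (_∘_)
open import Function.Bundles using (_⇔_; mk⇔)
open import Relation.Binary.Definitions using (tri<; tri≈; tri>)
open import Relation.Binary.PropositionalEquality using (_≡_; _≢_; refl; sym; trans; cong; subst; subst₂)
open import Relation.Nullary using (¬_; Dec; yes; no; does; contradiction)
open import Relation.Nullary.Decidable using (_×-dec_; _⊎-dec_; _→-dec_; ¬?; dec-true; toWitness; toSum)

false≢true : false ≢ true
false≢true ()

does⇒ : ∀ {A : Set} (a? : Dec A) → does a? ≡ true → A
does⇒ (yes a) _ = a

-- Tournaments and homomorphisms out of them.

_⊢_⟶_ : (D : Digraph) → Fin (size D) → Fin (size D) → Set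
D ⊢ u ⟶ v = edge D u v ≡ true

Semicomplete : Digraph → Set
Semicomplete H = ∀ i j → i ≡ j ⊎ (H ⊢ i ⟶ j ⊎ H ⊢ j ⟶ i)

Tournament : Digraph → Set
Tournament H = Loopless H × Oriented H × Semicomplete H

tournament? : ∀ H → Dec (Tournament H)
tournament? H =
  all? (λ v → edge H v v ≟ᴮ false)
  ×-dec all? (λ u → all? λ v → (edge H u v ≟ᴮ true) →-dec (edge H v u ≟ᴮ false))
  ×-dec all? (λ i → all? λ j → (i ≟ j) ⊎-dec ((edge H i j ≟ᴮ true) ⊎-dec (edge H j i ≟ᴮ true)))

T4a-tournament : Tournament T4a
T4a-tournament = toWitness {a? = tournament? T4a} _

T4b-tournament : Tournament T4b
T4b-tournament = toWitness {a? = tournament? T4b} _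

RT5-tournament : Tournament RT5
RT5-tournament = toWitness {a? = tournament? RT5} _

T5c-tournament : Tournament T5c
T5c-tournament = toWitness {a? = tournament? T5c} _

module _ {H D : Digraph} (tour : Tournament H) (loopless : Loopless D) where
  private
    ¬loop : ∀ {v} → ¬ D ⊢ v ⟶ v
    ¬loop {v} vv = false≢true (trans (sym (loopless v)) vv)

  -- Distinct vertices of a tournament are adjacent, so identifying them would put a loop on their
  -- image.
  hom-injective : ((f , _) : Hom H D) → ∀ {i j} → f i ≡ f j → i ≡ j
  hom-injective (f , f-hom) {i} {j} fi≡fj with proj₂ (proj₂ tour) i j
  ... | inj₁ i≡j        = i≡j
  ... | inj₂ (inj₁ i⟶j) = ⊥-elim (¬loop (subst (D ⊢_⟶ f j) fi≡fj (f-hom i j i⟶j)))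
  ... | inj₂ (inj₂ j⟶i) = ⊥-elim (¬loop (subst (D ⊢ f j ⟶_) fi≡fj (f-hom j i j⟶i)))

  -- A non-edge of a tournament is a diagonal pair or a reversed edge, and `D` has neither loops nor
  -- symmetric edges, so non-edges are preserved as well. Hence a forbidden tournament can be
  -- exhibited below by giving a homomorphism only.
  hom⇒induced : Oriented D → Hom H D → InducedSub H D
  hom⇒induced oriented f@(g , g-hom) = g , hom-injective f , edges
    where
    edges : ∀ i j → edge D (g i) (g j) ≡ edge H i j
    edges i j with proj₂ (proj₂ tour) i j
    ... | inj₁ refl       = trans (loopless (g i)) (sym (proj₁ tour i))
    ... | inj₂ (inj₁ i⟶j) = trans (g-hom i j i⟶j) (sym i⟶j)
    ... | inj₂ (inj₂ j⟶i) = trans (oriented _ _ (g-hom j i j⟶i)) (sym (proj₁ (proj₂ tour) j i j⟶i))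

induced⇒hom : ∀ {H D} → InducedSub H D → Hom H D
induced⇒hom (g , _ , edges) = g , λ i j → trans (edges i j)

hom-∘ : ∀ {G H K} → Hom G H → Hom H K → Hom G K
hom-∘ (f , f-hom) (g , g-hom) = g ∘ f , λ u v → g-hom (f u) (f v) ∘ f-hom u v

TT-tournament : ∀ m → Tournament (TT m)
TT-tournament m = loopless , oriented , semicomplete
  where
  loopless : Loopless (TT m)
  loopless v = ¬-not λ e → <-irrefl refl (does⇒ (toℕ v <? toℕ v) e)
  oriented : Oriented (TT m)
  oriented u v e = ¬-not λ e′ → <-asym (does⇒ (toℕ u <? toℕ v) e) (does⇒ (toℕ v <? toℕ u) e′)
  semicomplete : Semicomplete (TT m)
  semicomplete i j with <-cmp (toℕ i) (toℕ j)
  ... | tri< i<j _ _ = inj₂ (inj₁ (dec-true (toℕ i <? toℕ j) i<j))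
  ... | tri≈ _ i≡j _ = inj₁ (toℕ-injective i≡j)
  ... | tri> _ _ j<i = inj₂ (inj₂ (dec-true (toℕ j <? toℕ i) j<i))

-- The target `TC` on n = 2 + k vertices, described by the labels 0 to `last`.

module Circuit (k : ℕ) where

  last : ℕ
  last = suc k

  Forward Back Arc : ℕ → ℕ → Set
  Forward x y = x < y × ¬ (x ≡ 0 × y ≡ last)
  Back x y = x ≡ last × y ≡ 0
  Arc x y = Forward x y ⊎ Back x y

  arc? : ∀ x y → Dec (Arc x y)
  arc? x y = ((x <? y) ×-dec ¬? ((x ≟ᴺ 0) ×-dec (y ≟ᴺ last))) ⊎-dec ((x ≟ᴺ last) ×-dec (y ≟ᴺ 0))

  -- The Boolean edge relation of TC is, definitionally, the decision `does (arc? _ _)`.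
  edge⁻ : ∀ {x y} → TC (2 + k) ⊢ x ⟶ y → Arc (toℕ x) (toℕ y)
  edge⁻ {x} {y} = does⇒ (arc? (toℕ x) (toℕ y))

  edge⁺ : ∀ {x y} → Arc (toℕ x) (toℕ y) → TC (2 + k) ⊢ x ⟶ y
  edge⁺ {x} {y} = dec-true (arc? (toℕ x) (toℕ y))

  arc-irrefl : ∀ {x} → ¬ Arc x x
  arc-irrefl (inj₁ (x<x , _)) = <-irrefl refl x<x
  arc-irrefl (inj₂ (refl , ()))

  arc-asym : ∀ {x y} → Arc x y → ¬ Arc y x
  arc-asym (inj₁ (x<y , _))       (inj₁ (y<x , _))   = <-asym x<y y<x
  arc-asym (inj₁ (_ , ¬0l))       (inj₂ (y≡l , x≡0)) = ¬0l (x≡0 , y≡l)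
  arc-asym (inj₂ (x≡l , y≡0))     (inj₁ (_ , ¬0l))   = ¬0l (y≡0 , x≡l)
  arc-asym (inj₂ (refl , _))      (inj₂ (_ , ()))

  arc-total : ∀ x y → x ≡ y ⊎ (Arc x y ⊎ Arc y x)
  arc-total x y with <-cmp x y
  ... | tri≈ _ x≡y _ = inj₁ x≡y
  arc-total x y | tri< x<y _ _ with (x ≟ᴺ 0) ×-dec (y ≟ᴺ last)
  ... | yes (x≡0 , y≡l) = inj₂ (inj₂ (inj₂ (y≡l , x≡0)))
  ... | no ¬0l          = inj₂ (inj₁ (inj₁ (x<y , ¬0l)))
  arc-total x y | tri> _ _ y<x with (y ≟ᴺ 0) ×-dec (x ≟ᴺ last)
  ... | yes (y≡0 , x≡l) = inj₂ (inj₁ (inj₂ (x≡l , y≡0)))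
  ... | no ¬0l          = inj₂ (inj₂ (inj₁ (y<x , ¬0l)))

  TC-tournament : Tournament (TC (2 + k))
  TC-tournament =
      (λ v → ¬-not (arc-irrefl ∘ edge⁻ {v} {v}))
    , (λ u v u⟶v → ¬-not (arc-asym (edge⁻ {u} {v} u⟶v) ∘ edge⁻ {v} {u}))
    , λ i j → map⊎ toℕ-injective (map⊎ (edge⁺ {i} {j}) (edge⁺ {j} {i})) (arc-total (toℕ i) (toℕ j))

  -- Forward arcs increase the label, so a closed walk has to use the arc from `last` to 0.
  triangle-back : ∀ {x y z} → Arc x y → Arc y z → Arc z x → Back x y ⊎ (Back y z ⊎ Back z x)
  triangle-back (inj₂ b) _ _ = inj₁ b
  triangle-back _ (inj₂ b) _ = inj₂ (inj₁ b)
  triangle-back _ _ (inj₂ b) = inj₂ (inj₂ b)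
  triangle-back (inj₁ (x<y , _)) (inj₁ (y<z , _)) (inj₁ (z<x , _)) =
    ⊥-elim (<-asym x<y (<-trans y<z z<x))

  -- Only `last` has an arc to 0, and it has none to itself.
  ¬dominates-back : ∀ {v x y} → Arc v x → Arc v y → ¬ Back x y
  ¬dominates-back v⟶l (inj₂ (refl , _)) (refl , _) = arc-irrefl v⟶l
  ¬dominates-back _ (inj₁ (v<y , _)) (_ , refl) = n≮0 v<y

  -- Among the labels up to `last`, only 0 receives an arc from `last`, and 0 receives none from
  -- itself.
  ¬dominated-back : ∀ {v x y} → v ≤ last → Arc x v → Arc y v → ¬ Back x y
  ¬dominated-back v≤l (inj₁ (l<v , _)) _ (refl , _) = <-irrefl refl (≤-trans l<v v≤l)
  ¬dominated-back _ (inj₂ (_ , refl)) 0⟶0 (_ , refl) = arc-irrefl 0⟶0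

  fin≤last : (x : Fin (2 + k)) → toℕ x ≤ last
  fin≤last x = s≤s⁻¹ (toℕ<n x)

  -- Tournaments that do not map to `TC`.

  module HomFromTournament {H : Digraph} (tour : Tournament H) (f : Hom H (TC (2 + k))) where
    private
      φ : Fin (size H) → ℕ
      φ = toℕ ∘ proj₁ f

      arc : ∀ {u v} → H ⊢ u ⟶ v → Arc (φ u) (φ v)
      arc {u} {v} = edge⁻ {proj₁ f u} {proj₁ f v} ∘ proj₂ f u v

      φ-injective : ∀ {u v} → φ u ≡ φ v → u ≡ v
      φ-injective = hom-injective {D = TC (2 + k)} tour (proj₁ TC-tournament) f ∘ toℕ-injective

      loop : ∀ {u v} → u ≡ v → ¬ H ⊢ u ⟶ v
      loop refl = arc-irrefl ∘ arc

      -- By injectivity of `φ`, two pairs that are both mapped to the arc from `last` to 0 coincide;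
      -- `targets` is the other half.
      sources : ∀ {u v u′ v′} → Back (φ u) (φ v) → Back (φ u′) (φ v′) → u ≡ u′
      sources (p , _) (q , _) = φ-injective (trans p (sym q))

      targets : ∀ {u v u′ v′} → Back (φ u) (φ v) → Back (φ u′) (φ v′) → v ≡ v′
      targets (_ , p) (_ , q) = φ-injective (trans p (sym q))

    -- Some edge of the triangle is mapped to the arc from `last` to 0, whose ends have no common
    -- in-neighbour.
    ¬source-over-triangle : ∀ {v x y z} → H ⊢ v ⟶ x → H ⊢ v ⟶ y → H ⊢ v ⟶ z →
      H ⊢ x ⟶ y → H ⊢ y ⟶ z → H ⊢ z ⟶ x → ⊥
    ¬source-over-triangle vx vy vz xy yz zx with triangle-back (arc xy) (arc yz) (arc zx)
    ... | inj₁ b        = ¬dominates-back (arc vx) (arc vy) b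
    ... | inj₂ (inj₁ b) = ¬dominates-back (arc vy) (arc vz) b
    ... | inj₂ (inj₂ b) = ¬dominates-back (arc vz) (arc vx) b

    ¬triangle-over-sink : ∀ {v x y z} → H ⊢ x ⟶ v → H ⊢ y ⟶ v → H ⊢ z ⟶ v →
      H ⊢ x ⟶ y → H ⊢ y ⟶ z → H ⊢ z ⟶ x → ⊥
    ¬triangle-over-sink {v} xv yv zv xy yz zx with triangle-back (arc xy) (arc yz) (arc zx)
    ... | inj₁ b        = ¬dominated-back (fin≤last (proj₁ f v)) (arc xv) (arc yv) b
    ... | inj₂ (inj₁ b) = ¬dominated-back (fin≤last (proj₁ f v)) (arc yv) (arc zv) b
    ... | inj₂ (inj₂ b) = ¬dominated-back (fin≤last (proj₁ f v)) (arc zv) (arc xv) b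

    -- Every triangle contains the edge mapped to last → 0, so no two are edge-disjoint.
    ¬two-triangles-at-a-vertex : ∀ {a b d e s} → a ≢ d → b ≢ e →
      H ⊢ a ⟶ b → H ⊢ b ⟶ s → H ⊢ s ⟶ a → H ⊢ d ⟶ e → H ⊢ e ⟶ s → H ⊢ s ⟶ d → ⊥
    ¬two-triangles-at-a-vertex a≢d b≢e ab bs sa de es sd
      with triangle-back (arc ab) (arc bs) (arc sa) | triangle-back (arc de) (arc es) (arc sd)
    ... | inj₁ p        | inj₁ q        = a≢d (sources p q)
    ... | inj₁ p        | inj₂ (inj₁ q) = loop (targets p q) bs
    ... | inj₁ p        | inj₂ (inj₂ q) = loop (sym (sources p q)) sa
    ... | inj₂ (inj₁ p) | inj₁ q        = loop (sym (targets p q)) es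
    ... | inj₂ (inj₁ p) | inj₂ (inj₁ q) = b≢e (sources p q)
    ... | inj₂ (inj₁ p) | inj₂ (inj₂ q) = loop (sources p q) bs
    ... | inj₂ (inj₂ p) | inj₁ q        = loop (sources p q) sd
    ... | inj₂ (inj₂ p) | inj₂ (inj₁ q) = loop (sym (sources p q)) es
    ... | inj₂ (inj₂ p) | inj₂ (inj₂ q) = a≢d (targets p q)

  ¬T4a⟶TC : ¬ Hom T4a (TC (2 + k))
  ¬T4a⟶TC f = ¬source-over-triangle {# 0} {# 1} {# 2} {# 3} refl refl refl refl refl refl
    where open HomFromTournament T4a-tournament f

  ¬T4b⟶TC : ¬ Hom T4b (TC (2 + k))
  ¬T4b⟶TC f = ¬triangle-over-sink {# 0} {# 1} {# 2} {# 3} refl refl refl refl refl refl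
    where open HomFromTournament T4b-tournament f

  ¬RT5⟶TC : ¬ Hom RT5 (TC (2 + k))
  -- The triangles 0, 1, 2 and 3, 4, 2 of `RT5` have only the vertex 2 in common.
  ¬RT5⟶TC f = ¬two-triangles-at-a-vertex {# 0} {# 1} {# 3} {# 4} {# 2}
    (λ ()) (λ ()) refl refl refl refl refl refl
    where open HomFromTournament RT5-tournament f

  ¬T5c⟶TC : ¬ Hom T5c (TC (2 + k))
  -- In the labels 1 to 5 of `T5c` these are the triangles 1, 3, 5 and 2, 4, 5.
  ¬T5c⟶TC f = ¬two-triangles-at-a-vertex {# 0} {# 2} {# 1} {# 3} {# 4}
    (λ ()) (λ ()) refl refl refl refl refl refl
    where open HomFromTournament T5c-tournament f

  ¬TC⁺⟶TC : ¬ InducedSub (TC (2 + k + 1)) (TC (2 + k))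
  ¬TC⁺⟶TC (_ , injective , _) =
    1+n≰n (subst (_≤ 2 + k) (+-comm (2 + k) 1) (injective⇒≤ injective))

  -- An embedding would be onto, but in TT no vertex lies on a triangle whereas 0 → 1 → last → 0 is one in TC.
  ¬TT⟶TC : 0 < k → ¬ InducedSub (TT (2 + k)) (TC (2 + k))
  ¬TT⟶TC 0<k (g , injective , edges) = <-irrefl refl (<-trans i<j (<-trans j<l l<i))
    where
    onto : ∀ y → ∃ λ x → g x ≡ y
    onto y with any? (λ x → g x ≟ y)
    ... | yes found = found
    ... | no missed = contradiction
      (injective⇒≤ {f = λ x → punchOut (y≢g x)} (injective ∘ punchOut-injective (y≢g _) (y≢g _)))
      1+n≰n
      where
      y≢g : ∀ x → y ≢ g x
      y≢g x y≡gx = missed (x , sym y≡gx)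
    pull : ∀ {x y} → Arc (toℕ x) (toℕ y) → toℕ (proj₁ (onto x)) < toℕ (proj₁ (onto y))
    pull {x} {y} a = does⇒ (toℕ (proj₁ (onto x)) <? toℕ (proj₁ (onto y)))
      (trans (sym (edges _ _))
        (subst₂ (TC (2 + k) ⊢_⟶_) (sym (proj₂ (onto x))) (sym (proj₂ (onto y))) (edge⁺ {x} {y} a)))
    top : Fin (2 + k)
    top = fromℕ (suc k)
    top≡last : toℕ top ≡ last
    top≡last = toℕ-fromℕ (suc k)
    i<j : toℕ (proj₁ (onto zero)) < toℕ (proj₁ (onto (suc zero)))
    -- Positivity of `k` separates the label 1 from `last`, so the pair 0, 1 is not the reversed
    -- one.
    i<j = pull {zero} {suc zero} (inj₁ (s≤s z≤n , λ { (_ , refl) → <-irrefl refl 0<k }))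
    j<l : toℕ (proj₁ (onto (suc zero))) < toℕ (proj₁ (onto top))
    j<l = pull {suc zero} {top} (inj₁ (subst (1 <_) (sym top≡last) (s≤s 0<k) , λ ()))
    l<i : toℕ (proj₁ (onto top)) < toℕ (proj₁ (onto zero))
    l<i = pull {top} {zero} (inj₂ (top≡last , refl))

-- Necessity of the conditions.

module _ (k : ℕ) where
  open Circuit k

  -- A forbidden graph in `D` would map to `TC` by composition. For the last two graphs the
  -- composite is used as an embedding, which is what the arguments by counting vertices refute.
  hom⇒forbidden : 0 < k → ∀ {D} → Hom D (TC (2 + k)) →
    Loopless D × Oriented D
    × ¬ InducedSub T4a D × ¬ InducedSub T4b D × ¬ InducedSub RT5 D
    × ¬ InducedSub T5c D × ¬ InducedSub (TT (2 + k)) D × ¬ InducedSub (TC (2 + k + 1)) D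
  hom⇒forbidden 0<k {D} f@(φ , φ-hom) =
      (λ v → ¬-not λ vv → false≢true (trans (sym (proj₁ TC-tournament (φ v))) (φ-hom v v vv)))
    , (λ u v uv → ¬-not λ vu → false≢true
        (trans (sym (proj₁ (proj₂ TC-tournament) (φ u) (φ v) (φ-hom u v uv))) (φ-hom v u vu)))
    , ¬T4a⟶TC ∘ composite , ¬T4b⟶TC ∘ composite , ¬RT5⟶TC ∘ composite , ¬T5c⟶TC ∘ composite
    , ¬TT⟶TC 0<k ∘ embedding (TT-tournament (2 + k))
    , ¬TC⁺⟶TC ∘ embedding (subst (Tournament ∘ TC) (+-comm 1 (2 + k)) (Circuit.TC-tournament (suc k)))
    where
    composite : ∀ {H} → InducedSub H D → Hom H (TC (2 + k))
    composite {H} h = hom-∘ {H} {D} {TC (2 + k)} (induced⇒hom {H} {D} h) f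
    embedding : ∀ {H} → Tournament H → InducedSub H D → InducedSub H (TC (2 + k))
    embedding {H} tour h =
      hom⇒induced {H} tour (proj₁ TC-tournament) (proj₁ (proj₂ TC-tournament)) (composite {H} h)

-- Quasi-transitivity.

module QuasiTransitive (D : Digraph) (p3free : P3free D) (loopless : Loopless D) (oriented : Oriented D) where

  V : Set
  V = Fin (size D)

  infix 4 _⟶_ _⟶?_
  _⟶_ : V → V → Set
  u ⟶ v = D ⊢ u ⟶ v

  _⟶?_ : ∀ u v → Dec (u ⟶ v)
  u ⟶? v = edge D u v ≟ᴮ true

  asym : ∀ {u v} → u ⟶ v → ¬ v ⟶ u
  asym {u} {v} uv vu = false≢true (trans (sym (oriented u v uv)) vu)

  distinct : ∀ {u v} → u ⟶ v → u ≢ v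
  distinct {u} uu refl = false≢true (trans (sym (loopless u)) uu)

  -- If `u` and `w` were not adjacent, `u`, `v`, `w` would induce `P3`; they are three vertices
  -- because a return from `v` to `u` is excluded by asymmetry.
  quasiTransitive : ∀ {u v w} → u ⟶ v → v ⟶ w → u ⟶ w ⊎ w ⟶ u
  quasiTransitive {u} {v} {w} uv vw with u ⟶? w | w ⟶? u
  ... | yes uw | _      = inj₁ uw
  ... | no _   | yes wu = inj₂ wu
  ... | no ¬uw | no ¬wu = ⊥-elim (p3free (g , injective , edges))
    where
    g : Fin 3 → V
    g zero             = u
    g (suc zero)       = v
    g (suc (suc zero)) = w
    injective : ∀ {i j} → g i ≡ g j → i ≡ j
    injective {zero}           {zero}           _  = refl
    injective {zero}           {suc zero}       eq = ⊥-elim (distinct uv eq)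
    injective {zero}           {suc (suc zero)} eq = ⊥-elim (asym uv (subst (v ⟶_) (sym eq) vw))
    injective {suc zero}       {zero}           eq = ⊥-elim (distinct uv (sym eq))
    injective {suc zero}       {suc zero}       _  = refl
    injective {suc zero}       {suc (suc zero)} eq = ⊥-elim (distinct vw eq)
    injective {suc (suc zero)} {zero}           eq = ⊥-elim (asym uv (subst (v ⟶_) eq vw))
    injective {suc (suc zero)} {suc zero}       eq = ⊥-elim (distinct vw (sym eq))
    injective {suc (suc zero)} {suc (suc zero)} _  = refl
    edges : ∀ i j → edge D (g i) (g j) ≡ edge P3 i j
    edges zero             zero             = loopless u
    edges zero             (suc zero)       = uv
    edges zero             (suc (suc zero)) = ¬-not ¬uw
    edges (suc zero)       zero             = oriented u v uv
    edges (suc zero)       (suc zero)       = loopless v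
    edges (suc zero)       (suc (suc zero)) = vw
    edges (suc (suc zero)) zero             = ¬-not ¬wu
    edges (suc (suc zero)) (suc zero)       = oriented v w vw
    edges (suc (suc zero)) (suc (suc zero)) = loopless w

  -- Heights in a set of vertices on which the edge relation is transitive.

  module Height (S : V → Set) (S? : ∀ v → Dec (S v))
    (transitive : ∀ {u v w} → S u → S v → S w → u ⟶ v → v ⟶ w → u ⟶ w) where

    -- Only consecutive vertices are required to be joined, which keeps the predicate decidable by
    -- recursion. The index counts edges, so there is one more vertex.
    ChainTo : ℕ → V → Set
    ChainTo zero    v = S v
    ChainTo (suc l) v = S v × ∃ λ u → u ⟶ v × ChainTo l u

    chainTo? : ∀ l v → Dec (ChainTo l v)
    chainTo? zero    v = S? v
    chainTo? (suc l) v = S? v ×-dec any? (λ u → (u ⟶? v) ×-dec chainTo? l u)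

    DescendingChain : ℕ → V → Set
    DescendingChain l v = Σ (Fin (suc l) → V) λ g →
      g zero ≡ v × (∀ i → S (g i)) × (∀ i j → toℕ i < toℕ j → g j ⟶ g i)

    -- Transitivity joins all pairs of the chain. The recursion peels off the last vertex, so the
    -- listing starts there and edges run against the indices.
    descendingChain : ∀ l {v} → ChainTo l v → DescendingChain l v
    descendingChain zero {v} c = (λ _ → v) , refl , (λ _ → c) , λ { zero zero () }
    descendingChain (suc l) {v} (sv , u , uv , c) with descendingChain l c
    ... | g , g0≡u , inS , desc = g′ , refl , inS′ , desc′
      where
      g′ : Fin (suc (suc l)) → V
      g′ zero    = v
      g′ (suc i) = g i
      inS′ : ∀ i → S (g′ i)
      inS′ zero    = sv
      inS′ (suc i) = inS i
      g0⟶v : g zero ⟶ v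
      g0⟶v = subst (_⟶ v) (sym g0≡u) uv
      desc′ : ∀ i j → toℕ i < toℕ j → g′ j ⟶ g′ i
      desc′ zero    (suc zero)    _         = g0⟶v
      desc′ zero    (suc (suc j)) _         =
        transitive (inS (suc j)) (inS zero) sv (desc zero (suc j) 0<1+n) g0⟶v
      desc′ (suc i) (suc j)       (s≤s i<j) = desc i j i<j

    indicator : ∀ {P : Set} → Dec P → ℕ
    indicator (yes _) = 1
    indicator (no _)  = 0

    indicator≤1 : ∀ {P : Set} (p? : Dec P) → indicator p? ≤ 1
    indicator≤1 (yes _) = ≤-refl
    indicator≤1 (no _)  = z≤n

    indicator-mono : ∀ {P Q : Set} (p? : Dec P) (q? : Dec Q) → (P → Q) → indicator p? ≤ indicator q?
    indicator-mono (yes p) (yes _) _ = ≤-refl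
    indicator-mono (yes p) (no ¬q) f = contradiction (f p) ¬q
    indicator-mono (no _)  _       _ = z≤n

    -- Counts the i < l such that some chain with i + 1 vertices ends at v.
    height : ℕ → V → ℕ
    height zero    v = 0
    height (suc l) v = indicator (chainTo? l v) + height l v

    height≤ : ∀ l v → height l v ≤ l
    height≤ zero    v = z≤n
    height≤ (suc l) v = +-mono-≤ (indicator≤1 (chainTo? l v)) (height≤ l v)

    -- Every chain counted at `u` extends to `v` with one more edge, and the one-vertex chain at `v`
    -- supplies the additional unit.
    height-edge : ∀ l {u v} → S v → u ⟶ v → suc (height l u) ≤ height (suc l) v
    height-edge zero {u} {v} sv uv with S? v
    ... | yes _  = ≤-refl
    ... | no ¬sv = contradiction sv ¬sv
    height-edge (suc l) {u} {v} sv uv =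
      subst (_≤ height (suc (suc l)) v) (+-suc (indicator (chainTo? l u)) (height l u))
        (+-mono-≤ (indicator-mono (chainTo? l u) (chainTo? (suc l) v) (λ c → sv , u , uv , c))
                  (height-edge l sv uv))

    height-pos : ∀ l {v} → S v → 1 ≤ height (suc l) v
    height-pos zero {v} sv with S? v
    ... | yes _  = ≤-refl
    ... | no ¬sv = contradiction sv ¬sv
    height-pos (suc l) {v} sv = +-mono-≤ (z≤n {indicator (chainTo? (suc l) v)}) (height-pos l sv)

    module _ (l : ℕ) (noChain : ∀ v → ¬ ChainTo l v) where

      -- No chain has `l` edges, so the extra level counts nothing and the two bounds above can be
      -- read at the same level `l`.
      height-stable : ∀ v → height (suc l) v ≡ height l v
      height-stable v with chainTo? l v
      ... | yes c = contradiction c (noChain v)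
      ... | no _  = refl

      height-mono : ∀ {u v} → S v → u ⟶ v → height l u < height l v
      height-mono {u} {v} sv uv = subst (suc (height l u) ≤_) (height-stable v) (height-edge l sv uv)

      height-positive : ∀ {v} → S v → 1 ≤ height l v
      height-positive {v} sv = subst (1 ≤_) (height-stable v) (height-pos l sv)

  descending⇒TT : ∀ {m} (g : Fin m → V) → (∀ i j → toℕ i < toℕ j → g j ⟶ g i) → Hom (TT m) D
  descending⇒TT {m} g desc = g ∘ opposite , λ i j i⟶j →
    desc (opposite j) (opposite i)
      (subst₂ _<_ (sym (opposite-prop j)) (sym (opposite-prop i))
        (∸-monoʳ-< (s≤s (does⇒ (toℕ i <? toℕ j) i⟶j)) (toℕ<n j)))

  -- Triangles and the classes of vertices around them.

  Triangle : V → V → V → Set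
  Triangle a b c = a ⟶ b × b ⟶ c × c ⟶ a

  triangle? : ∀ a b c → Dec (Triangle a b c)
  triangle? a b c = (a ⟶? b) ×-dec (b ⟶? c) ×-dec (c ⟶? a)

  rotate : ∀ {a b c} → Triangle a b c → Triangle b c a
  rotate (ab , bc , ca) = bc , ca , ab

  Between : V → V → V → Set
  Between u w v = u ⟶ v × v ⟶ w

  between? : ∀ u w v → Dec (Between u w v)
  between? u w v = (u ⟶? v) ×-dec (v ⟶? w)

  -- The disjuncts are the classes A, B, C in this order; `a`, `b`, `c` themselves belong to A, B, C
  -- respectively.
  Covers : V → V → V → V → Set
  Covers a b c v = Between c b v ⊎ (Between a c v ⊎ Between b a v)

  covers? : ∀ a b c v → Dec (Covers a b c v)
  covers? a b c v = between? c b v ⊎-dec (between? a c v ⊎-dec between? b a v)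

  -- The symmetry that allows the statements below to be proved for one class only.
  covers-rotate : ∀ {a b c v} → Covers a b c v → Covers b c a v
  covers-rotate (inj₁ p)        = inj₂ (inj₂ p)
  covers-rotate (inj₂ (inj₁ p)) = inj₁ p
  covers-rotate (inj₂ (inj₂ p)) = inj₂ (inj₁ p)

  -- Structure around a triangle without the four small tournaments.

  module Forbidden (¬T4a : ¬ InducedSub T4a D) (¬T4b : ¬ InducedSub T4b D)
                   (¬RT5 : ¬ InducedSub RT5 D) (¬T5c : ¬ InducedSub T5c D) where

    ¬source-over-triangle : ∀ {v x y z} → v ⟶ x → v ⟶ y → v ⟶ z → ¬ Triangle x y z
    ¬source-over-triangle {v} {x} {y} {z} vx vy vz (xy , yz , zx) =
      ¬T4a (hom⇒induced {T4a} T4a-tournament loopless oriented (f , hom))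
      where
      f : Fin 4 → V
      f zero                   = v
      f (suc zero)             = x
      f (suc (suc zero))       = y
      f (suc (suc (suc zero))) = z
      hom : ∀ i j → T4a ⊢ i ⟶ j → f i ⟶ f j
      hom zero                   (suc zero)             _ = vx
      hom zero                   (suc (suc zero))       _ = vy
      hom zero                   (suc (suc (suc zero))) _ = vz
      hom (suc zero)             (suc (suc zero))       _ = xy
      hom (suc (suc zero))       (suc (suc (suc zero))) _ = yz
      hom (suc (suc (suc zero))) (suc zero)             _ = zx

    ¬triangle-over-sink : ∀ {v x y z} → x ⟶ v → y ⟶ v → z ⟶ v → ¬ Triangle x y z
    ¬triangle-over-sink {v} {x} {y} {z} xv yv zv (xy , yz , zx) =
      ¬T4b (hom⇒induced {T4b} T4b-tournament loopless oriented (f , hom))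
      where
      f : Fin 4 → V
      f zero                   = v
      f (suc zero)             = x
      f (suc (suc zero))       = y
      f (suc (suc (suc zero))) = z
      hom : ∀ i j → T4b ⊢ i ⟶ j → f i ⟶ f j
      hom (suc zero)             zero                   _ = xv
      hom (suc (suc zero))       zero                   _ = yv
      hom (suc (suc (suc zero))) zero                   _ = zv
      hom (suc zero)             (suc (suc zero))       _ = xy
      hom (suc (suc zero))       (suc (suc (suc zero))) _ = yz
      hom (suc (suc (suc zero))) (suc zero)             _ = zx

    -- Quasi-transitivity carries the adjacency around the triangle, forwards if `v` dominates `a`
    -- and backwards otherwise. A change of direction puts `v` in a class; without one, `v` and the
    -- triangle form `T4a` or `T4b`.
    covers-adjacent-first : ∀ {a b c v} → Triangle a b c → v ⟶ a ⊎ a ⟶ v → Covers a b c v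
    covers-adjacent-first (ab , bc , ca) (inj₁ va) with quasiTransitive va ab
    ... | inj₂ bv = inj₂ (inj₂ (bv , va))
    ... | inj₁ vb with quasiTransitive vb bc
    ...   | inj₁ vc = ⊥-elim (¬source-over-triangle va vb vc (ab , bc , ca))
    ...   | inj₂ cv = inj₁ (cv , vb)
    covers-adjacent-first (ab , bc , ca) (inj₂ av) with quasiTransitive ca av
    ... | inj₂ vc = inj₂ (inj₁ (av , vc))
    ... | inj₁ cv with quasiTransitive bc cv
    ...   | inj₁ bv = ⊥-elim (¬triangle-over-sink av bv cv (ab , bc , ca))
    ...   | inj₂ vb = inj₁ (cv , vb)

    -- With `u` in place of `a` there is again a triangle, and it covers `v`. Then `v` is in the
    -- wanted class already or is adjacent to `b` or `c`, which lie on the original triangle.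
    covers-closed-first : ∀ {a b c u v} → Triangle a b c → Between c b u → u ⟶ v ⊎ v ⟶ u → Covers a b c v
    covers-closed-first t@(_ , bc , _) (cu , ub) u~v with covers-adjacent-first (ub , bc , cu) (swap u~v)
    ... | inj₁ cvb             = inj₁ cvb
    ... | inj₂ (inj₁ (_ , vc)) =
      covers-rotate (covers-adjacent-first (rotate (rotate t)) (inj₁ vc))
    ... | inj₂ (inj₂ (bv , _)) =
      covers-rotate (covers-rotate (covers-adjacent-first (rotate t) (inj₂ bv)))

    covers-closed : ∀ {a b c u v} → Triangle a b c → Covers a b c u → u ⟶ v ⊎ v ⟶ u → Covers a b c v
    covers-closed t (inj₁ p)        = covers-closed-first t p
    covers-closed t (inj₂ (inj₁ p)) = covers-rotate ∘ covers-rotate ∘ covers-closed-first (rotate t) p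
    covers-closed t (inj₂ (inj₂ p)) = covers-rotate ∘ covers-closed-first (rotate (rotate t)) p

    -- In the RT5 case the vertices in the cyclic order x, a, b, y, c receive the labels 0, 3, 1, 4, 2.
    between-complete : ∀ {a b c x y} → Triangle a b c → Between c b x → Between a c y → x ⟶ y
    between-complete {a} {b} {c} {x} {y} (ab , bc , ca) (cx , xb) (ay , yc) with quasiTransitive yc cx
    ... | inj₂ xy = xy
    -- Once `y` dominates `x`, the pairs `a`, `x` and `y`, `b` are adjacent too. All choices of
    -- their directions but one contain `T4a`; the remaining one is `RT5`.
    ... | inj₁ yx with quasiTransitive ay yx | quasiTransitive yx xb
    ...   | _       | inj₁ yb = ⊥-elim (¬source-over-triangle yx yb yc (xb , bc , cx))
    ...   | inj₁ ax | inj₂ by = ⊥-elim (¬source-over-triangle ax ab ay (xb , by , yx))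
    ...   | inj₂ xa | inj₂ by = ⊥-elim (¬RT5 (hom⇒induced {RT5} RT5-tournament loopless oriented (f , hom)))
      where
      f : Fin 5 → V
      f zero                         = x
      f (suc zero)                   = b
      f (suc (suc zero))             = c
      f (suc (suc (suc zero)))       = a
      f (suc (suc (suc (suc zero)))) = y
      hom : ∀ i j → RT5 ⊢ i ⟶ j → f i ⟶ f j
      hom zero                         (suc zero)                   _ = xb
      hom zero                         (suc (suc (suc zero)))       _ = xa
      hom (suc zero)                   (suc (suc zero))             _ = bc
      hom (suc zero)                   (suc (suc (suc (suc zero)))) _ = by
      hom (suc (suc zero))             (suc (suc (suc zero)))       _ = ca
      hom (suc (suc zero))             zero                         _ = cx
      hom (suc (suc (suc zero)))       (suc (suc (suc (suc zero)))) _ = ay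
      hom (suc (suc (suc zero)))       (suc zero)                   _ = ab
      hom (suc (suc (suc (suc zero)))) zero                         _ = yx
      hom (suc (suc (suc (suc zero)))) (suc (suc zero))             _ = yc
      hom zero                         (suc (suc (suc (suc zero)))) ()
      hom (suc (suc zero))             (suc (suc (suc (suc zero)))) ()
      hom (suc (suc (suc (suc zero)))) (suc (suc (suc zero)))       ()
      hom (suc (suc (suc (suc zero)))) (suc (suc (suc (suc zero)))) ()

    HasEdge : V → V → Set
    HasEdge u w = ∃ λ x → ∃ λ y → Between u w x × Between u w y × x ⟶ y

    hasEdge? : ∀ u w → Dec (HasEdge u w)
    hasEdge? u w = any? λ x → any? λ y → between? u w x ×-dec between? u w y ×-dec (x ⟶? y)

    -- As the first class dominates the second, the two edges span a transitive tournament on four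
    -- vertices. Its first two are dominated by `c` and its last two dominate `c`, which is `T5c`.
    ¬two-hasEdge : ∀ {a b c} → Triangle a b c → HasEdge c b → ¬ HasEdge a c
    ¬two-hasEdge {c = c} t (x , x′ , p , p′ , xx′) (y , y′ , q , q′ , yy′) =
      ¬T5c (hom⇒induced {T5c} T5c-tournament loopless oriented (f , hom))
      where
      f : Fin 5 → V
      f zero                         = x
      f (suc zero)                   = x′
      f (suc (suc zero))             = y
      f (suc (suc (suc zero)))       = y′
      f (suc (suc (suc (suc zero)))) = c
      hom : ∀ i j → T5c ⊢ i ⟶ j → f i ⟶ f j
      hom zero                         (suc zero)                   _ = xx′
      hom (suc zero)                   (suc (suc zero))             _ = between-complete t p′ q
      hom (suc (suc zero))             (suc (suc (suc zero)))       _ = yy′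
      hom zero                         (suc (suc zero))             _ = between-complete t p q
      hom zero                         (suc (suc (suc zero)))       _ = between-complete t p q′
      hom (suc zero)                   (suc (suc (suc zero)))       _ = between-complete t p′ q′
      hom (suc (suc (suc (suc zero)))) zero                         _ = proj₁ p
      hom (suc (suc (suc (suc zero)))) (suc zero)                   _ = proj₁ p′
      hom (suc (suc zero))             (suc (suc (suc (suc zero)))) _ = proj₂ q
      hom (suc (suc (suc zero)))       (suc (suc (suc (suc zero)))) _ = proj₂ q′

    -- A directed triangle inside the class would be dominated by `a`.
    between-transitive : ∀ {a c u v w} → Between a c u → Between a c v → Between a c w →
      u ⟶ v → v ⟶ w → u ⟶ w
    between-transitive (au , _) (av , _) (aw , _) uv vw with quasiTransitive uv vw
    ... | inj₁ uw = uw
    ... | inj₂ wu = ⊥-elim (¬source-over-triangle au av aw (uv , vw , wu))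

    -- Colouring the vertices covered by one triangle.

    module Colouring (k : ℕ) (¬TT : ¬ InducedSub (TT (2 + k)) D) (¬TC : ¬ InducedSub (TC (3 + k)) D) where
      open Circuit k

      -- Put `a` before the chain and `c` after it: all edges run forwards except the one from `c`
      -- to `a`, which is `TC` on n + 1 vertices.
      ¬chain-between : ∀ {a c} (g : Fin (suc k) → V) → c ⟶ a →
        (∀ i → Between a c (g i)) → (∀ i j → toℕ i < toℕ j → g j ⟶ g i) → ⊥
      ¬chain-between {a} {c} g ca inS desc =
        ¬TC (hom⇒induced {TC (3 + k)} (Circuit.TC-tournament (suc k)) loopless oriented (f , hom))
        where
        -- Read backwards, as `f` does, this lists the chain upwards and ends with `c`.
        g⁺ : Fin (2 + k) → V
        g⁺ zero    = c
        g⁺ (suc i) = g i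
        desc⁺ : ∀ i j → toℕ i < toℕ j → g⁺ j ⟶ g⁺ i
        desc⁺ zero    (suc j) _         = proj₂ (inS j)
        desc⁺ (suc i) (suc j) (s≤s i<j) = desc i j i<j
        f : Fin (3 + k) → V
        f zero    = a
        f (suc i) = g⁺ (opposite i)
        opposite-last : ∀ i → toℕ i ≡ suc k → g⁺ (opposite i) ≡ c
        opposite-last i i≡l with opposite i in eq
        ... | zero  = refl
        ... | suc j = contradiction
          (trans (cong toℕ (sym eq)) (trans (opposite-prop i) (trans (cong (suc k ∸_) i≡l) (n∸n≡0 k))))
          1+n≢0
        a⟶inner : ∀ i → toℕ i ≢ suc k → a ⟶ g⁺ (opposite i)
        a⟶inner i i≢l with opposite i in eq
        ... | suc j = proj₁ (inS j)
        ... | zero  = contradiction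
          (≤-antisym (fin≤last i)
            (m∸n≡0⇒m≤n (trans (sym (opposite-prop i)) (cong toℕ eq))))
          i≢l
        hom : ∀ i j → TC (3 + k) ⊢ i ⟶ j → f i ⟶ f j
        hom zero (suc i) e with Circuit.edge⁻ (suc k) {zero} {suc i} e
        ... | inj₁ (_ , ¬0l) = a⟶inner i λ i≡l → ¬0l (refl , cong suc i≡l)
        hom (suc i) zero e with Circuit.edge⁻ (suc k) {suc i} {zero} e
        ... | inj₂ (i≡l , _) = subst (_⟶ a) (sym (opposite-last i (suc-injective i≡l))) ca
        hom (suc i) (suc j) e with Circuit.edge⁻ (suc k) {suc i} {suc j} e
        ... | inj₁ (s≤s i<j , _) = proj₂ (descending⇒TT g⁺ desc⁺) i j (dec-true (toℕ i <? toℕ j) i<j)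

      HomOn : (V → Set) → Set
      HomOn S = Σ (V → Fin (2 + k)) λ f → ∀ u v → u ⟶ v → S u → S v → TC (2 + k) ⊢ f u ⟶ f v

      -- A label of at least 1 is not the 0 of the reversed pair, so any larger label receives an
      -- arc from it.
      arc-fromℕ< : ∀ {x y} (x<n : x < 2 + k) (y<n : y < 2 + k) → 1 ≤ x → x < y →
        TC (2 + k) ⊢ fromℕ< x<n ⟶ fromℕ< y<n
      arc-fromℕ< x<n y<n 1≤x x<y = edge⁺ {fromℕ< x<n} {fromℕ< y<n}
        (subst₂ Arc (sym (toℕ-fromℕ< x<n)) (sym (toℕ-fromℕ< y<n))
          (inj₁ (x<y , λ { (refl , _) → n≮0 1≤x })))

      -- Heights in the middle class lie in 1 to `k`, strictly between the colours 0 and `last` of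
      -- the two edgeless classes. By `between-complete`, edges between classes follow the cyclic
      -- order of these colours.
      homOn-covers₁ : ∀ {a b c} → Triangle a b c → ¬ HasEdge c b → ¬ HasEdge b a → HomOn (Covers a b c)
      homOn-covers₁ {a} {b} {c} t@(ab , bc , ca) ¬edge-cb ¬edge-ba =
        (λ v → colour v (covers? a b c v)) , λ u v uv → edges uv (covers? a b c u) (covers? a b c v)
        where
        open Height (Between a c) (between? a c) between-transitive

        -- Such a chain has `suc k` vertices, as many as `¬chain-between` excludes.
        noChain : ∀ v → ¬ ChainTo k v
        noChain v chain with descendingChain k chain
        ... | g , _ , inS , desc = ¬chain-between g ca inS desc

        h : V → ℕ
        h = height k

        h<last : ∀ v → h v < last
        h<last v = s≤s (height≤ k v)

        h<n : ∀ v → h v < 2 + k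
        h<n v = m≤n⇒m≤1+n (h<last v)

        h>0 : ∀ {v} → Between a c v → 0 < h v
        h>0 = height-positive k noChain

        colour : ∀ v → Dec (Covers a b c v) → Fin (2 + k)
        colour v (yes (inj₁ _))        = zero
        colour v (yes (inj₂ (inj₁ _))) = fromℕ< (h<n v)
        colour v (yes (inj₂ (inj₂ _))) = fromℕ (suc k)
        -- A default colour outside the three classes, where `HomOn` imposes no condition.
        colour v (no _)                = zero

        edges : ∀ {u v} → u ⟶ v → (u? : Dec (Covers a b c u)) (v? : Dec (Covers a b c v)) →
          Covers a b c u → Covers a b c v → TC (2 + k) ⊢ colour u u? ⟶ colour v v?
        edges uv (no ¬u) _ u∈ _ = contradiction u∈ ¬u
        edges uv _ (no ¬v) _ v∈ = contradiction v∈ ¬v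
        edges uv (yes (inj₁ p)) (yes (inj₁ q)) _ _ = contradiction (_ , _ , p , q , uv) ¬edge-cb
        edges {u} {v} uv (yes (inj₁ p)) (yes (inj₂ (inj₁ q))) _ _ =
          edge⁺ {zero} {fromℕ< (h<n v)} (subst (Arc 0) (sym (toℕ-fromℕ< (h<n v)))
            (inj₁ (h>0 q , λ { (_ , h≡last) → <-irrefl h≡last (h<last v) })))
        edges uv (yes (inj₁ p)) (yes (inj₂ (inj₂ q))) _ _ =
          contradiction (between-complete (rotate (rotate t)) q p) (asym uv)
        edges uv (yes (inj₂ (inj₁ p))) (yes (inj₁ q)) _ _ =
          contradiction (between-complete t q p) (asym uv)
        edges {u} {v} uv (yes (inj₂ (inj₁ p))) (yes (inj₂ (inj₁ q))) _ _ =
          arc-fromℕ< (h<n u) (h<n v) (h>0 p) (height-mono k noChain q uv)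
        edges {u} {v} uv (yes (inj₂ (inj₁ p))) (yes (inj₂ (inj₂ q))) _ _ =
          edge⁺ {fromℕ< (h<n u)} {fromℕ (suc k)}
            (subst₂ Arc (sym (toℕ-fromℕ< (h<n u))) (sym (toℕ-fromℕ (suc k)))
              (inj₁ (h<last u , λ { (h≡0 , _) → <-irrefl (sym h≡0) (h>0 p) })))
        edges uv (yes (inj₂ (inj₂ p))) (yes (inj₁ q)) _ _ =
          edge⁺ {fromℕ (suc k)} {zero} (inj₂ (toℕ-fromℕ (suc k) , refl))
        edges uv (yes (inj₂ (inj₂ p))) (yes (inj₂ (inj₁ q))) _ _ =
          contradiction (between-complete (rotate t) q p) (asym uv)
        edges uv (yes (inj₂ (inj₂ p))) (yes (inj₂ (inj₂ q))) _ _ =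
          contradiction (_ , _ , p , q , uv) ¬edge-ba

      homOn-map : ∀ {S T : V → Set} → (∀ {v} → T v → S v) → HomOn S → HomOn T
      homOn-map T⊆S (f , hom) = f , λ u v uv Tu Tv → hom u v uv (T⊆S Tu) (T⊆S Tv)

      -- At most one class contains an edge. Two rotations move the first class to the middle, and
      -- one rotation moves the third there.
      homOn-covers : ∀ {a b c} → Triangle a b c → HomOn (Covers a b c)
      homOn-covers {a} {b} {c} t with hasEdge? c b | hasEdge? b a
      ... | no ¬cb | no ¬ba = homOn-covers₁ t ¬cb ¬ba
      ... | yes cb | _      = homOn-map (covers-rotate ∘ covers-rotate)
        (homOn-covers₁ (rotate (rotate t)) (λ ba → ¬two-hasEdge (rotate (rotate t)) ba cb) (¬two-hasEdge t cb))
      ... | no ¬cb | yes ba = homOn-map covers-rotate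
        (homOn-covers₁ (rotate t) (λ ac → ¬two-hasEdge (rotate t) ac ba) ¬cb)

      -- Gluing the colourings of the components.

      Covered : V × V × V → V → Set
      Covered (a , b , c) v = Triangle a b c × Covers a b c v

      covered? : ∀ t v → Dec (Covered t v)
      covered? (a , b , c) v = triangle? a b c ×-dec covers? a b c v

      covered-closed : ∀ t {u v} → Covered t u → u ⟶ v ⊎ v ⟶ u → Covered t v
      covered-closed _ (t , u∈) u~v = t , covers-closed t u∈ u~v

      -- Running through all candidates replaces choosing one triangle for each component.
      triples : List (V × V × V)
      triples = cartesianProduct (allFin _) (cartesianProduct (allFin _) (allFin _))

      Uncovered : V → Set
      Uncovered v = ¬ Any (λ t → Covered t v) triples

      uncovered-closed : ∀ {u v} → u ⟶ v → Uncovered u → Uncovered v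
      uncovered-closed uv ¬u v∈ = ¬u (Any.map (λ {t} v∈t → covered-closed t v∈t (inj₂ uv)) v∈)

      -- A triangle covers its own vertices: here `u` would lie between `w` and `v`.
      uncovered-transitive : ∀ {u v w} → Uncovered u → Uncovered v → Uncovered w →
        u ⟶ v → v ⟶ w → u ⟶ w
      uncovered-transitive {u} {v} {w} ¬u _ _ uv vw with quasiTransitive uv vw
      ... | inj₁ uw = uw
      ... | inj₂ wu = contradiction
        (lose (∈-cartesianProduct⁺ (∈-allFin u) (∈-cartesianProduct⁺ (∈-allFin v) (∈-allFin w)))
              ((uv , vw , wu) , inj₁ (wu , uv)))
        ¬u

      -- Without `TT` on n vertices the heights of uncovered vertices lie in 1 to `last`. They avoid
      -- the colour 0, so each increase in height is an arc.
      homOn-uncovered : HomOn Uncovered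
      homOn-uncovered = (λ v → fromℕ< (h<n v)) , λ u v uv u∉ v∉ →
        arc-fromℕ< (h<n u) (h<n v) (height-positive (suc k) noChain u∉) (height-mono (suc k) noChain v∉ uv)
        where
        open Height Uncovered (λ v → ¬? (Any.any? (λ t → covered? t v) triples)) uncovered-transitive

        noChain : ∀ v → ¬ ChainTo (suc k) v
        noChain v chain with descendingChain (suc k) chain
        ... | g , _ , _ , desc =
          ¬TT (hom⇒induced {TT (2 + k)} (TT-tournament (2 + k)) loopless oriented (descending⇒TT g desc))

        h<n : ∀ v → height (suc k) v < 2 + k
        h<n v = s≤s (height≤ (suc k) v)

      -- Being covered by a given triangle is invariant along edges, so each vertex may use
      -- the colouring of the first triangle that covers it.
      glue : (ts : List (V × V × V)) → Σ (V → Fin (2 + k)) λ f →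
        ∀ u v → u ⟶ v → Any (λ t → Covered t u) ts ⊎ Uncovered u → TC (2 + k) ⊢ f u ⟶ f v
      glue [] with homOn-uncovered
      ... | f , hom = f , λ { u v uv (inj₂ u∉) → hom u v uv u∉ (uncovered-closed uv u∉) }
      glue (t@(a , b , c) ∷ ts) with glue ts | triangle? a b c
      ... | f , hom | no ¬t = f , λ
        { u v uv (inj₁ (here (t , _))) → contradiction t ¬t
        ; u v uv (inj₁ (there u∈))     → hom u v uv (inj₁ u∈)
        ; u v uv (inj₂ u∉)             → hom u v uv (inj₂ u∉) }
      ... | f , hom | yes tri with homOn-covers tri
      ...   | g , g-hom = (λ v → select v (covers? a b c v)) ,
                λ u v uv → select-hom uv (covers? a b c u) (covers? a b c v)
        where
        select : ∀ v → Dec (Covers a b c v) → Fin (2 + k)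
        select v (yes _) = g v
        select v (no _)  = f v
        select-hom : ∀ {u v} → u ⟶ v → (u? : Dec (Covers a b c u)) (v? : Dec (Covers a b c v)) →
          Any (λ t → Covered t u) (t ∷ ts) ⊎ Uncovered u → TC (2 + k) ⊢ select u u? ⟶ select v v?
        select-hom uv (yes u∈) (yes v∈) _ = g-hom _ _ uv u∈ v∈
        select-hom uv (yes u∈) (no v∉)  _ = contradiction (covers-closed tri u∈ (inj₁ uv)) v∉
        select-hom uv (no u∉)  (yes v∈) _ = contradiction (covers-closed tri v∈ (inj₂ uv)) u∉
        select-hom uv (no u∉)  (no _) (inj₁ (here (_ , u∈))) = contradiction u∈ u∉
        select-hom uv (no u∉)  (no _) (inj₁ (there u∈ts))    = hom _ _ uv (inj₁ u∈ts)
        select-hom uv (no u∉)  (no _) (inj₂ u∉ts)            = hom _ _ uv (inj₂ u∉ts)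

      hom-TC : Hom D (TC (2 + k))
      hom-TC with glue triples
      ... | f , hom = f , λ u v uv → hom u v uv (covered-or-not u)
        where
        covered-or-not : ∀ u → Any (λ t → Covered t u) triples ⊎ Uncovered u
        covered-or-not u = toSum (Any.any? (λ t → covered? t u) triples)

-- The equivalence, with n written as 2 + k.

theorem60 : (n : ℕ) → 4 ≤ n → (D : Digraph) → P3free D →
    Hom D (TC n) ⇔
    (Loopless D × Oriented D
    × ¬ InducedSub T4a D × ¬ InducedSub T4b D × ¬ InducedSub RT5 D
    × ¬ InducedSub T5c D × ¬ InducedSub (TT n) D × ¬ InducedSub (TC (n + 1)) D)
theorem60 (suc (suc k)) (s≤s (s≤s 2≤k)) D p3free =
  mk⇔ (hom⇒forbidden k (≤-trans (s≤s z≤n) 2≤k))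
    λ (loopless , oriented , ¬T4a , ¬T4b , ¬RT5 , ¬T5c , ¬TT , ¬TC) →
      let open QuasiTransitive D p3free loopless oriented
          open Forbidden ¬T4a ¬T4b ¬RT5 ¬T5c
      in Colouring.hom-TC k ¬TT (¬TC ∘ subst (λ m → InducedSub (TC m) D) (+-comm 1 (2 + k)))
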